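{- Let $G$ be a connected graph of order $n$, maximum degree $3$, and girth at least $5$. Then $$Z(G)\leq \frac{n}{2}-\frac{n}{24\log_2(n)+6}+2.$$
   Context: All graphs are finite, simple and undirected; the girth is the length of a shortest cycle (infinite for forests). For a graph $G$ and a set $Z\subseteq V(G)$, let $\mathcal{F}(Z)$ be the set obtained from $Z$ by repeatedly adding a vertex $u$ outside the current set whenever $u$ is the unique neighbor outside the current set of some vertex in the current set, as long as possible. $Z$ is a zero forcing set of $G$ if $\mathcal{F}(Z)=V(G)$. The zero forcing number $Z(G)$ is the minimum cardinality of a zero forcing set of $G$. -}

module Defs where

open import Data.Nat using (ℕ; zero; suc; _+_; _*_; _^_; _≤_; _<_)
open import Data.Bool using (Bool; true; false)
open import Data.Fin using (Fin)
open import Data.Fin.Subset using (Subset; _∈_; ∣_∣)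
open import Data.Vec using (tabulate)
open import Data.Empty using (⊥)
open import Data.Product using (Σ; ∃; _×_)
open import Relation.Binary.PropositionalEquality using (_≡_; _≢_)

record Graph (n : ℕ) : Set where
  field
    adj     : Fin n → Fin n → Bool
    adj-sym : ∀ u v → adj u v ≡ adj v u
    adj-irr : ∀ v → adj v v ≡ false

module _ {n : ℕ} (G : Graph n) where
  open Graph G

  Edge : Fin n → Fin n → Set
  Edge u v = adj u v ≡ true

  nbhd : Fin n → Subset n
  nbhd v = tabulate (adj v)

  degree : Fin n → ℕ
  degree v = ∣ nbhd v ∣

  MaxDegree3 : Set
  MaxDegree3 = (∀ v → degree v ≤ 3) × (∃ λ v → degree v ≡ 3)

  data Reach : Fin n → Fin n → Set where
    here : ∀ {v} → Reach v v
    step : ∀ {u w v} → Edge u w → Reach w v → Reach u v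

  Connected : Set
  Connected = ∀ u v → Reach u v

  -- girth at least 5: no cycle of length 3 or 4
  -- (every cycle has length ≥ 3, so this is exactly "girth ≥ 5")
  Girth≥5 : Set
  Girth≥5 =
    (∀ a b c → Edge a b → Edge b c → Edge c a → ⊥)
    × (∀ a b c d → a ≢ c → b ≢ d →
         Edge a b → Edge b c → Edge c d → Edge d a → ⊥)

  -- The forcing closure F(Z): the least set containing Z and closed under
  -- the colour-change rule "if u is in the set and v is the unique neighbour
  -- of u outside the set, add v".  (Least fixed point of the rule = the
  -- result of applying it repeatedly as long as possible.)
  data Forced (Z : Subset n) : Fin n → Set where
    init  : ∀ {v} → v ∈ Z → Forced Z v
    force : ∀ {u v} → Forced Z u → Edge u v →
            (∀ w → Edge u w → w ≢ v → Forced Z w) → Forced Z v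

  IsZeroForcingSet : Subset n → Set
  IsZeroForcingSet Z = ∀ v → Forced Z v

  IsZeroForcingNumber : ℕ → Set
  IsZeroForcingNumber k =
    (Σ (Subset n) λ Z → IsZeroForcingSet Z × ∣ Z ∣ ≡ k)
    × (∀ Z → IsZeroForcingSet Z → k ≤ ∣ Z ∣)

-- BoundHolds z n  expresses the real inequality
--   z ≤ n/2 − n/(24·log₂ n + 6) + 2.
-- Since f(L) = n/2 − n/(24L+6) + 2 is continuous and increasing in L ≥ 0,
-- z ≤ f(log₂ n) iff z ≤ f(a/b) for every rational a/b (a,b ∈ ℕ, b > 0)
-- with a/b > log₂ n, i.e. n^b < 2^a.  Clearing the positive denominator
-- D = 24a + 6b (multiply by 2D):  2zD + 2nb ≤ (n + 4)D.
BoundHolds : ℕ → ℕ → Set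
BoundHolds z n = ∀ a b → 0 < b → n ^ b < 2 ^ a →
  2 * z * (24 * a + 6 * b) + 2 * n * b ≤ (n + 4) * (24 * a + 6 * b)

{-# OPTIONS --safe #-}
-- Colour the graph in phases. When nothing more is forced, every coloured vertex
-- with an uncoloured neighbour has exactly two of them, and placing one of the two
-- colours both: k placements colour 2k vertices. It suffices to find, while
-- uncoloured vertices remain, k ≤ K = 2d+2 placements colouring 2k+1 vertices, where
-- 2^d > n; summing over the phases gives (2K+1)(z−2) ≤ Kn.
-- Suppose no such gain exists. Then an uncoloured vertex never has two coloured
-- neighbours, since placing it would colour three vertices (they are distinct for
-- lack of 4-cycles); nor does a coloured vertex have an uncoloured neighbour next to a
-- leaf, since placing that leaf would colour three vertices. So from a non-leaf
-- neighbour of a coloured vertex, the uncoloured part branches in two at every step.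
-- Two branches of length d meeting again would give a gain after at most 2d
-- placements, so there are 2^d > n distinct vertices, a contradiction.
module Submission where

open import Defs
open import Data.Nat using (ℕ; zero; suc; _+_; _*_; _^_; _≤_; _<_; z≤n; s≤s; _≤?_)
import Data.Nat.Properties as ℕ
open import Data.Nat.Tactic.RingSolver using (solve-∀)
import Data.Bool as Bool
open import Data.Bool using (true; false)
open import Data.Empty using (⊥; ⊥-elim)
open import Data.Fin using (Fin; _≟_)
open import Data.Fin.Properties using (any?; all?)
open import Data.Fin.Subset as Subset using (Subset; ∣_∣; ⁅_⁆; _∪_)
open import Data.Fin.Subset.Properties using
  ( x∈⁅x⁆; ∣⁅x⁆∣≡1; ∣⊥∣≡0; ∣⊤∣≡n; ∈⊤; p⊆p∪q; q⊆p∪q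
  ; x∈p∧x≢y⇒x∈p-y; x∈p⇒∣p-x∣<∣p∣; Empty-unique)
open import Data.List.Base using (List; []; _∷_; _++_; length; [_])
open import Data.List.Properties using (length-++)
open import Data.List.Membership.Propositional using (_∈_; _∉_)
open import Data.List.Membership.Propositional.Properties using (∈-++⁺ʳ; ∈-++⁻)
open import Data.List.Relation.Unary.All as All using (All; []; _∷_)
open import Data.List.Relation.Unary.All.Properties using (¬Any⇒All¬)
open import Data.List.Relation.Unary.Any using (here; there)
open import Data.List.Relation.Unary.AllPairs using ([]; _∷_)
open import Data.List.Relation.Unary.Unique.Propositional using (Unique)
import Data.List.Relation.Unary.Unique.Propositional.Properties as Unique
open import Data.Product using (∃-syntax; _×_; _,_; proj₁; proj₂)
open import Data.Sum using (_⊎_; inj₁; inj₂; [_,_]′)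
open import Data.Vec.Base using ([]; _∷_)
open import Data.Vec.Properties using (lookup⇒[]=; []=⇒lookup; lookup∘tabulate)
open import Relation.Binary.PropositionalEquality using (_≡_; _≢_; refl; sym; trans; cong; cong₂; subst)
open import Relation.Nullary using (¬_; Dec; yes; no; contradiction)
open import Relation.Nullary.Decidable using (_×-dec_; _→-dec_; ¬?; decidable-stable)
open import Function using (_∘_)

-- Repetition-free lists and sizes of subsets.

unique-∷ : ∀ {A : Set} {x : A} {xs} → x ∉ xs → Unique xs → Unique (x ∷ xs)
unique-∷ x∉xs u = ¬Any⇒All¬ _ x∉xs ∷ u

∉-∷ : ∀ {A : Set} {x y : A} {xs} → x ≢ y → x ∉ xs → x ∉ y ∷ xs
∉-∷ x≢y x∉xs (here x≡y) = x≢y x≡y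
∉-∷ x≢y x∉xs (there x∈xs) = x∉xs x∈xs

∈∉⇒≢ : ∀ {A : Set} {x y : A} {xs} → x ∈ xs → y ∉ xs → x ≢ y
∈∉⇒≢ x∈xs y∉xs refl = y∉xs x∈xs

unique-length≤∣∣ : ∀ {n} {xs : List (Fin n)} {p : Subset n} →
                   Unique xs → (∀ {x} → x ∈ xs → x Subset.∈ p) → length xs ≤ ∣ p ∣
unique-length≤∣∣ [] _ = z≤n
unique-length≤∣∣ (x≢xs ∷ u) xs⊆p =
  ℕ.≤-trans
    (s≤s (unique-length≤∣∣ u λ y∈xs →
      x∈p∧x≢y⇒x∈p-y (xs⊆p (there y∈xs)) (All.lookup x≢xs y∈xs ∘ sym)))
    (x∈p⇒∣p-x∣<∣p∣ (xs⊆p (here refl)))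

unique-length≤n : ∀ {n} {xs : List (Fin n)} → Unique xs → length xs ≤ n
unique-length≤n {n} {xs} u = subst (length xs ≤_) (∣⊤∣≡n n) (unique-length≤∣∣ {p = Subset.⊤} u λ _ → ∈⊤)

∣p∪q∣≤∣p∣+∣q∣ : ∀ {n} (p q : Subset n) → ∣ p ∪ q ∣ ≤ ∣ p ∣ + ∣ q ∣
∣p∪q∣≤∣p∣+∣q∣ [] [] = z≤n
∣p∪q∣≤∣p∣+∣q∣ (false ∷ p) (false ∷ q) = ∣p∪q∣≤∣p∣+∣q∣ p q
∣p∪q∣≤∣p∣+∣q∣ (false ∷ p) (true ∷ q) =
  ℕ.≤-trans (s≤s (∣p∪q∣≤∣p∣+∣q∣ p q)) (ℕ.≤-reflexive (sym (ℕ.+-suc ∣ p ∣ ∣ q ∣)))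
∣p∪q∣≤∣p∣+∣q∣ (true ∷ p) (false ∷ q) = s≤s (∣p∪q∣≤∣p∣+∣q∣ p q)
∣p∪q∣≤∣p∣+∣q∣ (true ∷ p) (true ∷ q) =
  s≤s (ℕ.≤-trans (∣p∪q∣≤∣p∣+∣q∣ p q) (ℕ.+-monoʳ-≤ ∣ p ∣ (ℕ.n≤1+n ∣ q ∣)))

-- Arithmetic of the bound.

-- This is `(2K+1)(c - 2) ≤ K l` without subtraction; the 2 pays for the starting state.
Bound : ℕ → ℕ → ℕ → Set
Bound K c l = suc (K + K) * c ≤ K * l + suc (K + K) * 2

-- One phase contributes `(2K+1)k ≤ K(2k+1)`, which is just `k ≤ K`.
bound-step : ∀ {K k c l l′} → k ≤ K → suc (k + k + l) ≤ l′ → Bound K c l → Bound K (k + c) l′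
bound-step {K} {k} {c} {l} {l′} k≤K grows bound = begin
  suc (K + K) * (k + c)                            ≡⟨ eq₁ K k c ⟩
  k + (K * (k + k) + suc (K + K) * c)              ≤⟨ ℕ.+-mono-≤ k≤K (ℕ.+-monoʳ-≤ (K * (k + k)) bound) ⟩
  K + (K * (k + k) + (K * l + suc (K + K) * 2))    ≡⟨ eq₂ K k l ⟩
  K * suc (k + k + l) + suc (K + K) * 2            ≤⟨ ℕ.+-monoˡ-≤ (suc (K + K) * 2) (ℕ.*-monoʳ-≤ K grows) ⟩
  K * l′ + suc (K + K) * 2                         ∎
  where
  open ℕ.≤-Reasoning
  eq₁ : ∀ K k c → suc (K + K) * (k + c) ≡ k + (K * (k + k) + suc (K + K) * c)
  eq₁ = solve-∀
  eq₂ : ∀ K k l → K + (K * (k + k) + (K * l + suc (K + K) * 2)) ≡ K * suc (k + k + l) + suc (K + K) * 2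
  eq₂ = solve-∀

binary-length : ∀ {n} → 1 ≤ n → ∃[ e ] 2 ^ e ≤ n × n < 2 ^ suc e
binary-length {suc zero} _ = 0 , ℕ.≤-refl , ℕ.≤-refl
binary-length {suc (suc n)} _ with binary-length {suc n} (s≤s z≤n)
... | e , lower , upper with 2 ^ suc e ≤? suc (suc n)
...   | yes 2^[1+e]≤ = suc e , 2^[1+e]≤ , ℕ.≤-<-trans upper (ℕ.^-monoʳ-< 2 (s≤s (s≤s z≤n)) (ℕ.n<1+n (suc e)))
...   | no 2^[1+e]≰ = e , ℕ.≤-trans lower (ℕ.n≤1+n _) , ℕ.≰⇒> 2^[1+e]≰

log-bound : ∀ {n} e a b → 2 ^ e ≤ n → n ^ b < 2 ^ a → e * b ≤ a
log-bound {n} e a b 2^e≤n n^b<2^a = ℕ.≮⇒≥ λ a<e*b → ℕ.<⇒≱ n^b<2^a (begin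
  2 ^ a        ≤⟨ ℕ.^-monoʳ-≤ 2 (ℕ.<⇒≤ a<e*b) ⟩
  2 ^ (e * b)  ≡⟨ ℕ.^-*-assoc 2 e b ⟨
  (2 ^ e) ^ b  ≤⟨ ℕ.^-monoˡ-≤ b 2^e≤n ⟩
  n ^ b        ∎)
  where open ℕ.≤-Reasoning

-- Here `K = 2e+4`, so `2b(2K+1) = 8eb + 18b`. With `e * b ≤ a`, and `b ≤ a` because `2 ≤ n`, this
-- is at most `20a + 6b`.
bound⇒boundHolds : ∀ e {z n} → 2 ≤ n → 2 ^ e ≤ n →
                   Bound (2 + (suc e + suc e)) z n → BoundHolds z n
bound⇒boundHolds e {z} {n} 2≤n 2^e≤n bound a b 0<b n^b<2^a =
  scale (2 + (suc e + suc e)) bound (begin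
    2 * b * suc (2 + (suc e + suc e) + (2 + (suc e + suc e)))  ≡⟨ eq e b ⟩
    8 * (e * b) + 12 * (1 * b) + 6 * b                         ≤⟨ ℕ.+-monoˡ-≤ (6 * b) (ℕ.+-mono-≤
                                                                    (ℕ.*-monoʳ-≤ 8 (log-bound e a b 2^e≤n n^b<2^a))
                                                                    (ℕ.*-monoʳ-≤ 12 (log-bound 1 a b 2≤n n^b<2^a))) ⟩
    8 * a + 12 * a + 6 * b                                     ≤⟨ ℕ.m≤m+n _ (4 * a) ⟩
    8 * a + 12 * a + 6 * b + 4 * a                             ≡⟨ eq′ a b ⟩
    24 * a + 6 * b                                             ∎)
  where
  open ℕ.≤-Reasoning
  eq : ∀ e b → 2 * b * suc (2 + (suc e + suc e) + (2 + (suc e + suc e))) ≡ 8 * (e * b) + 12 * (1 * b) + 6 * b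
  eq = solve-∀
  eq′ : ∀ a b → 8 * a + 12 * a + 6 * b + 4 * a ≡ 24 * a + 6 * b
  eq′ = solve-∀
  scale : ∀ {D} K → Bound K z n → 2 * b * suc (K + K) ≤ D → 2 * z * D + 2 * n * b ≤ (n + 4) * D
  scale {D} K bd 2bM≤D = ℕ.*-cancelˡ-≤ (suc (K + K)) (begin
    suc (K + K) * (2 * z * D + 2 * n * b)                       ≡⟨ eq₁ K z D n b ⟩
    2 * D * (suc (K + K) * z) + n * (2 * b * suc (K + K))       ≤⟨ ℕ.+-mono-≤ (ℕ.*-monoʳ-≤ (2 * D) bd) (ℕ.*-monoʳ-≤ n 2bM≤D) ⟩
    2 * D * (K * n + suc (K + K) * 2) + n * D                   ≡⟨ eq₂ K D n ⟩
    suc (K + K) * ((n + 4) * D)                                 ∎)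
    where
    eq₁ : ∀ K z D n b → suc (K + K) * (2 * z * D + 2 * n * b) ≡ 2 * D * (suc (K + K) * z) + n * (2 * b * suc (K + K))
    eq₁ = solve-∀
    eq₂ : ∀ K D n → 2 * D * (K * n + suc (K + K) * 2) + n * D ≡ suc (K + K) * ((n + 4) * D)
    eq₂ = solve-∀

-- Edges, leaves and cherries.

module _ {n : ℕ} (G : Graph n) where
  open Graph G

  open import Data.List.Membership.DecPropositional (_≟_ {n}) using (_∈?_)

  edge? : ∀ u v → Dec (Edge G u v)
  edge? u v = adj u v Bool.≟ true

  edge-sym : ∀ {u v} → Edge G u v → Edge G v u
  edge-sym {u} {v} e = trans (adj-sym v u) e

  edge⇒≢ : ∀ {u v} → Edge G u v → u ≢ v
  edge⇒≢ {u} e refl with trans (sym e) (adj-irr u)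
  ... | ()

  edge⇒∈nbhd : ∀ {u v} → Edge G u v → v Subset.∈ nbhd G u
  edge⇒∈nbhd {u} {v} e = lookup⇒[]= v (nbhd G u) (trans (lookup∘tabulate (adj u) v) e)

  ∈nbhd⇒edge : ∀ {u v} → v Subset.∈ nbhd G u → Edge G u v
  ∈nbhd⇒edge {u} {v} p = trans (sym (lookup∘tabulate (adj u) v)) ([]=⇒lookup p)

  Leaf : Fin n → Set
  Leaf v = ∀ a b → Edge G v a → Edge G v b → a ≡ b

  leaf? : ∀ v → Dec (Leaf v)
  leaf? v = all? λ a → all? λ b → edge? v a →-dec (edge? v b →-dec (a ≟ b))

  Cherry : Fin n → Fin n → Fin n → Set
  Cherry u a b = a ≢ b × Edge G u a × Edge G u b × Leaf a × Leaf b

  cherry? : ∀ u → Dec (∃[ a ] ∃[ b ] Cherry u a b)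
  cherry? u = any? λ a → any? λ b →
    ¬? (a ≟ b) ×-dec (edge? u a ×-dec (edge? u b ×-dec (leaf? a ×-dec leaf? b)))

  leaf⇒¬cherry : ∀ {u a b} → Leaf u → ¬ Cherry u a b
  leaf⇒¬cherry u-leaf (a≢b , ua , ub , _) = a≢b (u-leaf _ _ ua ub)

  ¬leaf⇒another : ∀ {v t} → ¬ Leaf v → ∃[ a ] Edge G v a × a ≢ t
  ¬leaf⇒another {v} {t} ¬leaf with any? (λ a → edge? v a ×-dec ¬? (a ≟ t))
  ... | yes found = found
  ... | no none = contradiction (λ a b va vb → trans (≡t va) (sym (≡t vb))) ¬leaf
    where
    ≡t : ∀ {a} → Edge G v a → a ≡ t
    ≡t {a} va = decidable-stable (a ≟ t) λ a≢t → none (a , va , a≢t)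

  exit : ∀ {F u v} → u ∈ F → v ∉ F → Reach G u v → ∃[ t ] ∃[ x ] t ∈ F × x ∉ F × Edge G t x
  exit u∈F v∉F here = contradiction u∈F v∉F
  exit {F} u∈F v∉F (step {w = w} uw r) with w ∈? F
  ... | yes w∈F = exit w∈F v∉F r
  ... | no w∉F = _ , _ , u∈F , w∉F , uw

  neighbour : ∀ {v} → degree G v ≡ 3 → ∃[ w ] Edge G v w
  neighbour {v} deg≡3 with any? (edge? v)
  ... | yes found = found
  ... | no none with trans (sym deg≡3) (trans (cong ∣_∣ (Empty-unique λ (w , w∈) → none (w , ∈nbhd⇒edge w∈))) (∣⊥∣≡0 n))
  ...   | ()

  -- Colouring sequences and states.

  -- Forcing c F: the vertices of F can be coloured, the last one first in the
  -- list, by placing c initial vertices and applying the colour-change rule.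
  -- Placing and forcing may be interleaved, and the rule need not be exhausted.
  data Forcing : ℕ → List (Fin n) → Set where
    start : Forcing 0 []
    place : ∀ {c F} x → Forcing c F → Forcing (suc c) (x ∷ F)
    apply : ∀ {c F u x} → Forcing c F → u ∈ F → Edge G u x →
            (∀ w → Edge G u w → w ≢ x → w ∈ F) → Forcing c (x ∷ F)

  Forced-mono : ∀ {Y Z : Subset n} → (∀ {v} → v Subset.∈ Y → v Subset.∈ Z) →
                ∀ {v} → Forced G Y v → Forced G Z v
  Forced-mono Y⊆Z (init v∈Y) = init (Y⊆Z v∈Y)
  Forced-mono Y⊆Z (force f e fs) = force (Forced-mono Y⊆Z f) e λ w uw w≢v → Forced-mono Y⊆Z (fs w uw w≢v)

  forcing⇒forced : ∀ {c F} → Forcing c F →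
                   ∃[ Z ] ∣ Z ∣ ≤ c × (∀ {v} → v ∈ F → Forced G Z v)
  forcing⇒forced start = Subset.⊥ , ℕ.≤-reflexive (∣⊥∣≡0 n) , λ ()
  forcing⇒forced (place x f) with forcing⇒forced f
  ... | Z , ∣Z∣≤c , F-forced = ⁅ x ⁆ ∪ Z , bound , forced
    where
    bound = ℕ.≤-trans (∣p∪q∣≤∣p∣+∣q∣ ⁅ x ⁆ Z)
              (ℕ.+-mono-≤ (ℕ.≤-reflexive (∣⁅x⁆∣≡1 x)) ∣Z∣≤c)
    forced : ∀ {v} → v ∈ x ∷ _ → Forced G (⁅ x ⁆ ∪ Z) v
    forced (here refl) = init (p⊆p∪q Z (x∈⁅x⁆ x))
    forced (there v∈F) = Forced-mono (q⊆p∪q ⁅ x ⁆ Z) (F-forced v∈F)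
  forcing⇒forced (apply f u∈F ux rest) with forcing⇒forced f
  ... | Z , ∣Z∣≤c , F-forced = Z , ∣Z∣≤c , λ where
    (here refl) → force (F-forced u∈F) ux λ w uw w≢x → F-forced (rest w uw w≢x)
    (there v∈F) → F-forced v∈F

  -- With degree at most three, an anchored vertex has at most two neighbours outside `F`.
  Anchored : List (Fin n) → Fin n → Set
  Anchored F v = ∃[ w ] w ∈ F × Edge G v w

  Covered : List (Fin n) → Fin n → Set
  Covered F u = ∀ {a b} → Cherry u a b → a ∈ F ⊎ b ∈ F

  -- A coloured vertex with two uncoloured leaves would be a dead end, where a
  -- placement colours two vertices and leads nowhere; `covered` excludes it.
  record State (c : ℕ) (F : List (Fin n)) : Set where
    field
      forcing  : Forcing c F
      unique   : Unique F
      anchored : ∀ {v} → v ∈ F → Anchored F v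
      covered  : ∀ {u} → u ∈ F → Covered F u

  -- Being anchored and being covered persist when `F` grows, so only the new vertices `xs` need
  -- checking.
  grow : ∀ {c c′ F} xs → State c F → Forcing c′ (xs ++ F) → Unique (xs ++ F) →
         All (Anchored (xs ++ F)) xs → All (Covered (xs ++ F)) xs → State c′ (xs ++ F)
  grow {F = F} xs S f u as cs = record
    { forcing  = f
    ; unique   = u
    ; anchored = λ v∈ → [ All.lookup as , old-anchored ]′ (∈-++⁻ xs v∈)
    ; covered  = λ v∈ ch → [ (λ v∈xs → All.lookup cs v∈xs ch) , (λ v∈F → old-covered v∈F ch) ]′ (∈-++⁻ xs v∈)
    }
    where
    open State S
    old-anchored : ∀ {v} → v ∈ F → Anchored (xs ++ F) v
    old-anchored v∈F with anchored v∈F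
    ... | w , w∈F , vw = w , ∈-++⁺ʳ xs w∈F , vw
    old-covered : ∀ {v} → v ∈ F → Covered (xs ++ F) v
    old-covered v∈F ch = [ inj₁ ∘ ∈-++⁺ʳ xs , inj₂ ∘ ∈-++⁺ʳ xs ]′ (covered v∈F ch)

  empty : State 0 []
  empty = record { forcing = start ; unique = [] ; anchored = λ () ; covered = λ () }

  -- Gains and stuck states.

  Gain : ℕ → ℕ → List (Fin n) → Set
  Gain j c F = ∃[ k ] ∃[ F′ ] k ≤ j × State (k + c) F′ × suc (k + k + length F) ≤ length F′

  gain-mono : ∀ {i j c F} → i ≤ j → Gain i c F → Gain j c F
  gain-mono i≤j (k , F′ , k≤i , rest) = k , F′ , ℕ.≤-trans k≤i i≤j , rest

  gain-after-pair : ∀ {j c F x y} → Gain j (suc c) (y ∷ x ∷ F) → Gain (suc j) c F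
  gain-after-pair {c = c} {F} (k , F′ , k≤j , S , long) =
    suc k , F′ , s≤s k≤j , subst (λ d → State d F′) (ℕ.+-suc k c) S ,
    subst (_≤ length F′) (eq k (length F)) long
    where
    eq : ∀ k l → suc (k + k + suc (suc l)) ≡ suc (suc k + suc k + l)
    eq = solve-∀

  -- `j` is the budget of placements left in the phase. A neutral move lowers it by one, since a
  -- gain after the move is a gain before it.
  record Stuck (j c : ℕ) (F : List (Fin n)) : Set where
    constructor stuck
    field
      state : State c F
      ¬gain : ¬ Gain j c F

  stuck-cast : ∀ {i j c F} → i ≡ j → Stuck i c F → Stuck j c F
  stuck-cast refl st = st

  stuck-mono : ∀ {i j c F} → i ≤ j → Stuck j c F → Stuck i c F
  stuck-mono {c = c} {F} i≤j (stuck S ¬gain) = stuck S (¬gain ∘ gain-mono {c = c} {F} i≤j)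

  Child : Fin n → Fin n → List (Fin n) → Fin n → Set
  Child t x H a = Edge G x a × a ≢ t × a ∉ H × ¬ Leaf a

  -- Non-backtracking walks of length d from x to z, t being the vertex before x.
  data Desc : ℕ → Fin n → Fin n → Fin n → Set where
    stop : ∀ {t x} → Desc 0 t x x
    go   : ∀ {d t x c z} → Edge G x c → c ≢ t → Desc d x c z → Desc (suc d) t x z

  -- Local structure of stuck states.

  module _ (degree≤3 : ∀ v → degree G v ≤ 3) (girth : Girth≥5 G) where

    no-four : ∀ {v a b c d} → Unique (a ∷ b ∷ c ∷ d ∷ []) →
              Edge G v a → Edge G v b → Edge G v c → Edge G v d → ⊥
    no-four {v} u va vb vc vd = ℕ.<⇒≱ (unique-length≤∣∣ u incl) (degree≤3 v)
      where
      incl : ∀ {x} → x ∈ _ → x Subset.∈ nbhd G v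
      incl = All.lookup (edge⇒∈nbhd {v} va ∷ edge⇒∈nbhd {v} vb ∷ edge⇒∈nbhd {v} vc ∷ edge⇒∈nbhd {v} vd ∷ [])

    last-neighbour : ∀ {v a b c w} → Edge G v a → Edge G v b → Edge G v c →
                     a ≢ b → a ≢ c → b ≢ c → Edge G v w → w ≢ c → w ≡ a ⊎ w ≡ b
    last-neighbour {a = a} {b} {c} {w} va vb vc a≢b a≢c b≢c vw w≢c with w ≟ a | w ≟ b
    ... | yes w≡a | _ = inj₁ w≡a
    ... | no _ | yes w≡b = inj₂ w≡b
    ... | no w≢a | no w≢b = contradiction vw (no-four
      ((a≢b ∷ a≢c ∷ w≢a ∘ sym ∷ []) ∷ (b≢c ∷ w≢b ∘ sym ∷ []) ∷ (w≢c ∘ sym ∷ []) ∷ [] ∷ [])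
      va vb vc)

    no-triangle : ∀ {a b c} → Edge G a b → Edge G a c → ¬ Edge G b c
    no-triangle ab ac bc = proj₁ girth _ _ _ ab bc (edge-sym ac)

    no-square : ∀ {s t x y} → s ≢ t → x ≢ y →
                Edge G s x → Edge G t x → Edge G s y → Edge G t y → ⊥
    no-square s≢t x≢y sx tx sy ty = proj₂ girth _ _ _ _ s≢t x≢y sx (edge-sym tx) ty (edge-sym sy)

    -- A coloured leaf is anchored at a coloured neighbour, which could only be `x`.
    leaf-unreached : ∀ {c F x ℓ} → State c F → x ∉ F → Edge G x ℓ → Leaf ℓ → ℓ ∉ F
    leaf-unreached S x∉F xℓ ℓ-leaf ℓ∈F with State.anchored S ℓ∈F
    ... | w , w∈F , ℓw = x∉F (subst (_∈ _) (ℓ-leaf _ _ ℓw (edge-sym xℓ)) w∈F)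

    -- Entering a cherry through one of its leaves: ℓ, then x, then ℓ′.
    cherry-gain : ∀ {c F t x ℓ ℓ′} → State c F → t ∈ F → x ∉ F → Edge G t x →
                  Cherry x ℓ ℓ′ → Gain 1 c F
    cherry-gain {F = F} {t} {x} {ℓ} {ℓ′} S t∈F x∉F tx (ℓ≢ℓ′ , xℓ , xℓ′ , ℓ-leaf , ℓ′-leaf) =
      1 , ℓ′ ∷ x ∷ ℓ ∷ F , ℕ.≤-refl ,
      grow (ℓ′ ∷ x ∷ ℓ ∷ []) S
        (apply
          (apply (place ℓ forcing) (here refl) (edge-sym xℓ)
            λ w ℓw w≢x → contradiction (ℓ-leaf _ _ ℓw (edge-sym xℓ)) w≢x)
          (here refl) xℓ′
          λ w xw w≢ℓ′ → [ (λ { refl → there (there t∈F) }) , (λ { refl → there (here refl) }) ]′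
            (last-neighbour (edge-sym tx) xℓ xℓ′ (∈∉⇒≢ t∈F ℓ∉F) (∈∉⇒≢ t∈F ℓ′∉F) ℓ≢ℓ′ xw w≢ℓ′))
        (unique-∷ (∉-∷ (edge⇒≢ xℓ′ ∘ sym) (∉-∷ (ℓ≢ℓ′ ∘ sym) ℓ′∉F))
          (unique-∷ (∉-∷ (edge⇒≢ xℓ) x∉F) (unique-∷ ℓ∉F unique)))
        ( (x , there (here refl) , edge-sym xℓ′)
        ∷ (t , there (there (there t∈F)) , edge-sym tx)
        ∷ (x , there (here refl) , edge-sym xℓ) ∷ [])
        ( (λ ch → contradiction ch (leaf⇒¬cherry ℓ′-leaf))
        ∷ x-covered
        ∷ (λ ch → contradiction ch (leaf⇒¬cherry ℓ-leaf)) ∷ []) ,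
      ℕ.≤-refl
      where
      open State S
      ℓ∉F = leaf-unreached S x∉F xℓ ℓ-leaf
      ℓ′∉F = leaf-unreached S x∉F xℓ′ ℓ′-leaf
      x-covered : Covered (ℓ′ ∷ x ∷ ℓ ∷ F) x
      x-covered {a} (_ , xa , _) with a ≟ ℓ′
      ... | yes refl = inj₁ (here refl)
      ... | no a≢ℓ′ with last-neighbour (edge-sym tx) xℓ xℓ′ (∈∉⇒≢ t∈F ℓ∉F) (∈∉⇒≢ t∈F ℓ′∉F) ℓ≢ℓ′ xa a≢ℓ′
      ...   | inj₁ refl = inj₁ (there (there (there t∈F)))
      ...   | inj₂ refl = inj₁ (there (there (here refl)))

    stuck⇒¬cherry : ∀ {j c F t x a b} → Stuck (1 + j) c F →
                    t ∈ F → x ∉ F → Edge G t x → ¬ Cherry x a b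
    stuck⇒¬cherry {F = F} (stuck S ¬gain) t∈F x∉F tx ch =
      ¬gain (gain-mono {F = F} (s≤s z≤n) (cherry-gain S t∈F x∉F tx ch))

    -- Otherwise `t` would force `x` for free, a gain with no placement.
    partner : ∀ {j c F t x} → Stuck (1 + j) c F → t ∈ F → x ∉ F → Edge G t x →
              ∃[ y ] Edge G t y × y ∉ F × y ≢ x
    partner {F = F} {t} {x} st@(stuck S ¬gain) t∈F x∉F tx
      with any? (λ y → edge? t y ×-dec (¬? (y ∈? F) ×-dec ¬? (y ≟ x)))
    ... | yes found = found
    ... | no none = ⊥-elim (¬gain
      ( 0 , x ∷ F , z≤n
      , grow [ x ] S
          (apply forcing t∈F tx λ w tw w≢x → decidable-stable (w ∈? F) λ w∉F → none (w , tw , w∉F , w≢x))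
          (unique-∷ x∉F unique)
          ((t , there t∈F , edge-sym tx) ∷ [])
          ((λ ch → contradiction ch (stuck⇒¬cherry st t∈F x∉F tx)) ∷ [])
      , ℕ.≤-refl))
      where open State S

    -- The anchor of `t` together with `x` and `y` exhausts its three possible neighbours.
    forced-by-pair : ∀ {c F H t x y} → State c F → t ∈ F → x ∉ F → y ∉ F → x ≢ y →
                     Edge G t x → Edge G t y → (∀ {v} → v ∈ F → v ∈ H) → x ∈ H →
                     ∀ w → Edge G t w → w ≢ y → w ∈ H
    forced-by-pair S t∈F x∉F y∉F x≢y tx ty F⊆H x∈H w tw w≢y with State.anchored S t∈F
    ... | s , s∈F , ts =
      [ (λ { refl → F⊆H s∈F }) , (λ { refl → x∈H }) ]′
        (last-neighbour ts tx ty (∈∉⇒≢ s∈F x∉F) (∈∉⇒≢ s∈F y∉F) x≢y tw w≢y)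

    -- Place `ℓ`; it forces `x`, and then `t` forces the partner `y`: three vertices for one
    -- placement.
    stuck⇒no-leaf : ∀ {j c F t x ℓ} → Stuck (1 + j) c F →
                    t ∈ F → x ∉ F → Edge G t x → Edge G x ℓ → ¬ Leaf ℓ
    stuck⇒no-leaf {F = F} {t} {x} {ℓ} st@(stuck S ¬gain) t∈F x∉F tx xℓ ℓ-leaf
      with partner st t∈F x∉F tx
    ... | y , ty , y∉F , y≢x = ¬gain
      ( 1 , y ∷ x ∷ ℓ ∷ F , s≤s z≤n
      , grow (y ∷ x ∷ ℓ ∷ []) S
          (apply
            (apply (place ℓ forcing) (here refl) (edge-sym xℓ)
              λ w ℓw w≢x → contradiction (ℓ-leaf _ _ ℓw (edge-sym xℓ)) w≢x)
            (there (there t∈F)) ty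
            (forced-by-pair S t∈F x∉F y∉F (y≢x ∘ sym) tx ty (there ∘ there) (here refl)))
          (unique-∷ (∉-∷ y≢x (∉-∷ y≢ℓ y∉F))
            (unique-∷ (∉-∷ (edge⇒≢ xℓ) x∉F) (unique-∷ ℓ∉F unique)))
          ( (t , there (there (there t∈F)) , edge-sym ty)
          ∷ (t , there (there (there t∈F)) , edge-sym tx)
          ∷ (x , there (here refl) , edge-sym xℓ) ∷ [])
          ( (λ ch → contradiction ch (stuck⇒¬cherry st t∈F y∉F ty))
          ∷ (λ ch → contradiction ch (stuck⇒¬cherry st t∈F x∉F tx))
          ∷ (λ ch → contradiction ch (leaf⇒¬cherry ℓ-leaf)) ∷ [])
      , ℕ.≤-refl)
      where
      open State S
      ℓ∉F = leaf-unreached S x∉F xℓ ℓ-leaf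
      y≢ℓ : y ≢ ℓ
      y≢ℓ refl = x∉F (subst (_∈ F) (ℓ-leaf _ _ (edge-sym ty) (edge-sym xℓ)) t∈F)

    -- The neutral move: place x, and t forces y.
    expand : ∀ {j c F t x y} → Stuck (1 + j) c F → t ∈ F → x ∉ F → y ∉ F → x ≢ y →
             Edge G t x → Edge G t y → Stuck j (suc c) (y ∷ x ∷ F)
    expand {F = F} {t} {x} {y} st@(stuck S ¬gain) t∈F x∉F y∉F x≢y tx ty =
      stuck (grow (y ∷ x ∷ []) S
        (apply (place x forcing) (there t∈F) ty
          (forced-by-pair S t∈F x∉F y∉F x≢y tx ty there (here refl)))
        (unique-∷ (∉-∷ (x≢y ∘ sym) y∉F) (unique-∷ x∉F unique))
        ((t , there (there t∈F) , edge-sym ty) ∷ (t , there (there t∈F) , edge-sym tx) ∷ [])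
        ( (λ ch → contradiction ch (stuck⇒¬cherry st t∈F y∉F ty))
        ∷ (λ ch → contradiction ch (stuck⇒¬cherry st t∈F x∉F tx)) ∷ []))
      (¬gain ∘ gain-after-pair {F = F} {x} {y})
      where open State S

    -- If both t and t′ see x, expanding t leaves t′ with a single uncoloured neighbour.
    stuck⇒one-parent : ∀ {j c F t t′ x} → Stuck (2 + j) c F → t ∈ F → t′ ∈ F → t ≢ t′ →
                       x ∉ F → Edge G t x → ¬ Edge G t′ x
    stuck⇒one-parent {F = F} {t′ = t′} {x} st t∈F t′∈F t≢t′ x∉F tx t′x
      with partner st t∈F x∉F tx | partner st t′∈F x∉F t′x
    ... | y , ty , y∉F , y≢x | z , t′z , z∉F , z≢x
      -- Without 4-cycles `z` is not `y`, so it stays uncoloured and needs a partner `u` again. Then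
      -- `t′` has four neighbours: its anchor `s`, `x`, `z` and `u`.
      with partner (expand st t∈F x∉F y∉F (y≢x ∘ sym) tx ty) (there (there t′∈F))
                   (∉-∷ z≢y (∉-∷ z≢x z∉F)) t′z
      where
      z≢y : z ≢ y
      z≢y refl = no-square t≢t′ (z≢x ∘ sym) tx t′x ty t′z
    ... | u , t′u , u∉ , u≢z with State.anchored (Stuck.state st) t′∈F
    ... | s , s∈F , t′s = no-four
      ((∈∉⇒≢ s∈F x∉F ∷ ∈∉⇒≢ s∈F z∉F ∷ ∈∉⇒≢ s∈F (u∉ ∘ there ∘ there) ∷ [])
        ∷ (z≢x ∘ sym ∷ (λ { refl → u∉ (there (here refl)) }) ∷ [])
        ∷ (u≢z ∘ sym ∷ []) ∷ [] ∷ [])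
      t′s t′x t′z t′u

    -- `a = y` would close a triangle, and `a ∈ F` would give `x` the two coloured neighbours `a`
    -- and `t`.
    child∉ : ∀ {j c F t x y a} → Stuck (2 + j) c F → t ∈ F → x ∉ F →
             Edge G t x → Edge G t y → Edge G x a → a ≢ t → a ∉ y ∷ x ∷ F
    child∉ st t∈F x∉F tx ty xa a≢t =
      ∉-∷ (λ { refl → no-triangle tx ty xa })
        (∉-∷ (edge⇒≢ xa ∘ sym)
          λ a∈F → stuck⇒one-parent st a∈F t∈F a≢t x∉F (edge-sym xa) tx)

    -- Walks through the uncoloured part.

    -- Walk along by neutral moves, one placement per step; `child∉` keeps the next vertex
    -- uncoloured, and the coloured list only grows.
    desc-uncoloured : ∀ {d j c F t x z} → Stuck (d + (2 + j)) c F → t ∈ F → x ∉ F → Edge G t x →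
                      Desc d t x z → z ∉ F
    desc-uncoloured st t∈F x∉F tx stop = x∉F
    desc-uncoloured {suc d} {j} st t∈F x∉F tx (go xa a≢t desc)
      with partner st t∈F x∉F tx
    ... | y , ty , y∉F , y≢x =
      desc-uncoloured (expand st t∈F x∉F y∉F (y≢x ∘ sym) tx ty) (there (here refl))
        (child∉ {d + suc j} (stuck-cast (cong suc (ℕ.+-suc d (suc j))) st) t∈F x∉F tx ty xa a≢t)
        xa desc
      ∘ there ∘ there

    -- The last clause allows a second walk, through b and e, to be followed afterwards.
    follow : ∀ {d j c F t x z} → Stuck (suc d + (2 + j)) c F → t ∈ F → x ∉ F → Edge G t x →
             Desc d t x z →
             ∃[ c′ ] ∃[ F′ ] Stuck (2 + j) c′ F′ × z ∈ F′ ×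
               (∀ {b e} → b ∈ F → b ≢ t → e ∉ F → Edge G b e → b ∈ F′ × e ∉ F′)
    follow {d} {j} {F = F} {t} {x} st t∈F x∉F tx desc with partner st t∈F x∉F tx
    ... | y , ty , y∉F , y≢x = continue desc
      where
      st″ : Stuck (2 + (d + suc j)) _ F
      st″ = stuck-cast (cong suc (ℕ.+-suc d (suc j))) st
      st′ = expand st t∈F x∉F y∉F (y≢x ∘ sym) tx ty
      -- If `e` were `x` or `y`, it would have the two coloured neighbours `b` and `t`.
      kept : ∀ {b e} → b ∈ F → b ≢ t → e ∉ F → Edge G b e → e ∉ y ∷ x ∷ F
      kept b∈F b≢t e∉F be =
        ∉-∷ (λ { refl → stuck⇒one-parent st″ b∈F t∈F b≢t e∉F be ty })
          (∉-∷ (λ { refl → stuck⇒one-parent st″ b∈F t∈F b≢t e∉F be tx }) e∉F)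
      continue : ∀ {z} → Desc d t x z →
                 ∃[ c′ ] ∃[ F′ ] Stuck (2 + j) c′ F′ × z ∈ F′ ×
                   (∀ {b e} → b ∈ F → b ≢ t → e ∉ F → Edge G b e → b ∈ F′ × e ∉ F′)
      continue stop =
        _ , _ , st′ , there (here refl) ,
        λ b∈F b≢t e∉F be → there (there b∈F) , kept b∈F b≢t e∉F be
      continue (go xa a≢t desc′)
        with follow st′ (there (here refl)) (child∉ st″ t∈F x∉F tx ty xa a≢t) xa desc′
      ... | c′ , F′ , st‴ , z∈F′ , keep =
        c′ , F′ , st‴ , z∈F′ ,
        λ b∈F b≢t e∉F be →
          keep (there (there b∈F)) (∈∉⇒≢ b∈F x∉F) (kept b∈F b≢t e∉F be) be

    -- After the first walk has been coloured up to z, the second one can still be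
    -- followed, which forces its end z to be uncoloured.
    separate : ∀ {d c F x a b z} → Stuck (2 + (d + d)) c F → x ∈ F → a ∉ F → b ∉ F → a ≢ b →
               Edge G x a → Edge G x b → Desc d x a z → ¬ Desc d x b z
    separate st x∈F a∉F b∉F a≢b xa xb stop stop = a≢b refl
    separate {suc d} st x∈F a∉F b∉F a≢b xa xb (go aa′ a′≢x desc) (go bb′ b′≢x desc′)
      with follow {d} {d} (stuck-cast eq st₁) (here refl)
             (child∉ st x∈F a∉F xa xb aa′ a′≢x ∘ swap) aa′ desc
      where
      -- Of the `2d+4` placements, one colours both `a` and `b` and `d+1` follow the first walk; the
      -- remaining `d+2` are what `desc-uncoloured` asks for on the second.
      st₁ = expand st x∈F b∉F a∉F (a≢b ∘ sym) xb xa
      eq : suc (suc d + suc d) ≡ suc d + (2 + d)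
      eq = cong suc (sym (ℕ.+-suc d (suc d)))
      swap : ∀ {u} → u ∈ _ ∷ _ ∷ _ → u ∈ _ ∷ _ ∷ _
      swap (here p) = there (here p)
      swap (there (here p)) = here p
      swap (there (there p)) = there (there p)
    ... | c′ , F′ , st₂ , z∈F′ , keep
      with keep (there (here refl)) (a≢b ∘ sym) (child∉ st x∈F b∉F xb xa bb′ b′≢x) bb′
    ... | b∈F′ , b′∉F′ =
      desc-uncoloured {d} {0} (stuck-cast (ℕ.+-comm 2 d) st₂) b∈F′ b′∉F′ bb′ desc′ z∈F′

    -- The binary tree of descendants.

    -- A non-leaf `x` has one child besides `t`; once `x` is coloured, `partner` supplies a second,
    -- and `stuck⇒no-leaf` excludes leaves.
    children : ∀ {j c F t x} → Stuck (3 + j) c F → t ∈ F → x ∉ F → Edge G t x → ¬ Leaf x →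
               ∃[ H ] Stuck (2 + j) (suc c) H × x ∈ H ×
                 ∃[ a ] ∃[ b ] a ≢ b × Child t x H a × Child t x H b
    children {F = F} {t} {x} st t∈F x∉F tx ¬leaf
      with partner st t∈F x∉F tx | ¬leaf⇒another {t = t} ¬leaf
    ... | y , ty , y∉F , y≢x | a , xa , a≢t = y ∷ x ∷ F , st′ , there (here refl) , pair
      where
      st′ = expand st t∈F x∉F y∉F (y≢x ∘ sym) tx ty
      a∉H = child∉ st t∈F x∉F tx ty xa a≢t
      ¬leaf-child : ∀ {u} → Edge G x u → ¬ Leaf u
      ¬leaf-child = stuck⇒no-leaf st t∈F x∉F tx
      pair : ∃[ a ] ∃[ b ] a ≢ b × Child t x (y ∷ x ∷ F) a × Child t x (y ∷ x ∷ F) b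
      pair with partner st′ (there (here refl)) a∉H xa
      ... | b , xb , b∉H , b≢a =
        a , b , b≢a ∘ sym , (xa , a≢t , a∉H , ¬leaf-child xa) ,
        (xb , ∈∉⇒≢ (there (there t∈F)) b∉H ∘ sym , b∉H , ¬leaf-child xb)

    descendants : ∀ d {c F t x} → Stuck (2 + (d + d)) c F → t ∈ F → x ∉ F → Edge G t x → ¬ Leaf x →
                  ∃[ L ] length L ≡ 2 ^ d × Unique L × (∀ {z} → z ∈ L → Desc d t x z)
    descendants zero {x = x} st t∈F x∉F tx ¬leaf =
      [ x ] , refl , [] ∷ [] , λ { (here refl) → stop }
    descendants (suc d) {t = t} {x} st t∈F x∉F tx ¬leaf = branch (children st t∈F x∉F tx ¬leaf)
      where
      branch : ∃[ H ] Stuck (2 + (d + suc d)) _ H × x ∈ H ×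
                 ∃[ a ] ∃[ b ] a ≢ b × Child t x H a × Child t x H b →
               ∃[ L ] length L ≡ 2 ^ suc d × Unique L × (∀ {z} → z ∈ L → Desc (suc d) t x z)
      branch (H , st′ , x∈H , a , b , a≢b , (xa , a≢t , a∉H , a-¬leaf) , (xb , b≢t , b∉H , b-¬leaf)) =
        join (descendants d st″ x∈H a∉H xa a-¬leaf) (descendants d st″ x∈H b∉H xb b-¬leaf)
        where
        -- Both subtrees start from the same `H`, so that `separate` applies to their ends; one
        -- spare placement is given up.
        st″ : Stuck (2 + (d + d)) _ H
        st″ = stuck-mono (s≤s (s≤s (ℕ.+-monoʳ-≤ d (ℕ.n≤1+n d)))) st′
        join : (∃[ L ] length L ≡ 2 ^ d × Unique L × (∀ {z} → z ∈ L → Desc d x a z)) →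
               (∃[ L ] length L ≡ 2 ^ d × Unique L × (∀ {z} → z ∈ L → Desc d x b z)) →
               ∃[ L ] length L ≡ 2 ^ suc d × Unique L × (∀ {z} → z ∈ L → Desc (suc d) t x z)
        join (L , len , uniq , desc) (L′ , len′ , uniq′ , desc′) =
          L ++ L′ ,
          trans (length-++ L) (cong₂ _+_ len (trans len′ (sym (ℕ.+-identityʳ _)))) ,
          Unique.++⁺ uniq uniq′ (λ (z∈L , z∈L′) →
            separate st″ x∈H a∉H b∉H a≢b xa xb (desc z∈L) (desc′ z∈L′)) ,
          λ z∈ → [ go xa a≢t ∘ desc , go xb b≢t ∘ desc′ ]′ (∈-++⁻ L z∈)

    -- At the boundary, a non-leaf `x` or `y` would have `2 ^ d` distinct descendants, more than
    -- `n`. If both are leaves, they form an uncoloured cherry at `t`, contrary to `covered`.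
    ¬stuck : ∀ {d c F v w} → Connected G → n < 2 ^ d → w ∈ F → v ∉ F → ¬ Stuck (2 + (d + d)) c F
    ¬stuck {d} {F = F} connected n<2^d w∈F v∉F st with exit w∈F v∉F (connected _ _)
    ... | t , x , t∈F , x∉F , tx with partner st t∈F x∉F tx
    ... | y , ty , y∉F , y≢x =
      ¬¬leaf x∉F tx λ x-leaf → ¬¬leaf y∉F ty λ y-leaf →
      [ x∉F , y∉F ]′ (State.covered (Stuck.state st) t∈F (y≢x ∘ sym , tx , ty , x-leaf , y-leaf))
      where
      ¬¬leaf : ∀ {u} → u ∉ F → Edge G t u → ¬ ¬ Leaf u
      ¬¬leaf u∉F tu ¬leaf =
        let L , len , uniq , _ = descendants d st t∈F u∉F tu ¬leaf
        in ℕ.<⇒≱ n<2^d (subst (_≤ n) len (unique-length≤n uniq))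

    -- The starting state and the iteration of phases.

    -- A cherry, if there is one, is the place to start: both its leaves are placed and its centre
    -- is forced. Without cherries `covered` is vacuous and any edge will do.
    initial-state : ∀ {v w} → Edge G v w → ∃[ F ] State 2 F × ∃[ u ] u ∈ F
    initial-state {v} {w} vw with any? cherry?
    ... | no ¬cherry =
      w ∷ v ∷ [] ,
      grow (w ∷ v ∷ []) empty (place w (place v start))
        (unique-∷ (∉-∷ (edge⇒≢ vw ∘ sym) λ ()) (unique-∷ (λ ()) []))
        ((v , there (here refl) , edge-sym vw) ∷ (w , here refl , vw) ∷ [])
        ((λ ch → contradiction (_ , _ , _ , ch) ¬cherry) ∷ (λ ch → contradiction (_ , _ , _ , ch) ¬cherry) ∷ []) ,
      w , here refl
    ... | yes (u , a , b , a≢b , ua , ub , a-leaf , b-leaf) =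
      b ∷ u ∷ a ∷ [] ,
      grow (b ∷ u ∷ a ∷ []) empty
        (place b (apply (place a start) (here refl) (edge-sym ua)
          λ w aw w≢u → contradiction (a-leaf _ _ aw (edge-sym ua)) w≢u))
        (unique-∷ (∉-∷ (edge⇒≢ ub ∘ sym) (∉-∷ (a≢b ∘ sym) λ ()))
          (unique-∷ (∉-∷ (edge⇒≢ ua) λ ()) (unique-∷ (λ ()) [])))
        ( (u , there (here refl) , edge-sym ub)
        ∷ (b , here refl , ub)
        ∷ (u , there (here refl) , edge-sym ua) ∷ [])
        ( (λ ch → contradiction ch (leaf⇒¬cherry b-leaf))
        ∷ u-covered
        ∷ (λ ch → contradiction ch (leaf⇒¬cherry a-leaf)) ∷ []) ,
      u , there (here refl)
      where
      u-covered : Covered (b ∷ u ∷ a ∷ []) u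
      u-covered {a′} {b′} (a′≢b′ , ua′ , ub′ , _) with a′ ∈? b ∷ u ∷ a ∷ [] | b′ ∈? b ∷ u ∷ a ∷ []
      ... | yes a′∈ | _ = inj₁ a′∈
      ... | no _ | yes b′∈ = inj₂ b′∈
      ... | no a′∉ | no b′∉ = contradiction ub′ (no-four
        ((a≢b ∷ ∈∉⇒≢ (there (there (here refl))) a′∉ ∷ ∈∉⇒≢ (there (there (here refl))) b′∉ ∷ [])
          ∷ (∈∉⇒≢ (here refl) a′∉ ∷ ∈∉⇒≢ (here refl) b′∉ ∷ [])
          ∷ (a′≢b′ ∷ []) ∷ [] ∷ [])
        ua ub ua′)

    module _ {K z : ℕ} (¬stuckᴷ : ∀ {c F v w} → w ∈ F → v ∉ F → ¬ Stuck K c F)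
             (z-minimal : ∀ Z → IsZeroForcingSet G Z → z ≤ ∣ Z ∣) where

      complete : ∀ {c F} → State c F → (∀ v → v ∈ F) → Bound K c (length F) → Bound K z n
      complete {c} {F} S all∈F bound with forcing⇒forced (State.forcing S)
      ... | Z , ∣Z∣≤c , forced = begin
        suc (K + K) * z               ≤⟨ ℕ.*-monoʳ-≤ (suc (K + K)) (ℕ.≤-trans (z-minimal Z (forced ∘ all∈F)) ∣Z∣≤c) ⟩
        suc (K + K) * c               ≤⟨ bound ⟩
        K * length F + suc (K + K) * 2 ≤⟨ ℕ.+-monoˡ-≤ _ (ℕ.*-monoʳ-≤ K (unique-length≤n (State.unique S))) ⟩
        K * n + suc (K + K) * 2       ∎
        where open ℕ.≤-Reasoning

      -- The bound on z is decidable, so the gain need only exist classically.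
      iterate : ∀ fuel {c F w} → State c F → w ∈ F → n ≤ fuel + length F →
                Bound K c (length F) → Bound K z n
      iterate fuel {c} {F} {w} S w∈F enough bound with all? (_∈? F)
      ... | yes all∈F = complete S all∈F bound
      ... | no ¬all∈F = decidable-stable (_ ≤? _) λ ¬bound →
        ¬all∈F λ v → decidable-stable (v ∈? F) λ v∉F →
        ¬stuckᴷ w∈F v∉F (stuck S (¬bound ∘ improve fuel v∉F enough))
        where
        improve : ∀ fuel {v} → v ∉ F → n ≤ fuel + length F → Gain K c F → Bound K z n
        -- Out of fuel, `F` already has `n` vertices, and `v` would be one more.
        improve zero v∉F enough _ =
          contradiction enough (ℕ.<⇒≱ (unique-length≤n (unique-∷ v∉F (State.unique S))))
        improve (suc fuel) v∉F enough (k , [] , k≤K , S′ , ())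
        improve (suc fuel) v∉F enough (k , F′@(_ ∷ _) , k≤K , S′ , grows) =
          iterate fuel S′ (here refl)
            (ℕ.≤-trans enough (ℕ.≤-trans (ℕ.≤-reflexive (sym (ℕ.+-suc fuel (length F))))
              (ℕ.+-monoʳ-≤ fuel (ℕ.≤-trans (s≤s (ℕ.m≤n+m (length F) (k + k))) grows))))
            (bound-step {K} {l = length F} k≤K grows bound)

theorem2 : (n : ℕ) (G : Graph n) → Connected G → MaxDegree3 G → Girth≥5 G →
    (k : ℕ) → IsZeroForcingNumber G k → BoundHolds k n
theorem2 n G connected (degree≤3 , v , deg≡3) girth k (_ , k-minimal) =
  let w , vw = neighbour G {v} deg≡3
      2≤n = unique-length≤n (unique-∷ {x = v} {w ∷ []} (∉-∷ (edge⇒≢ G vw) λ ()) (unique-∷ (λ ()) []))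
      e , 2^e≤n , n<2^[1+e] = binary-length (ℕ.≤-trans (s≤s z≤n) 2≤n)
      F , S , u , u∈F = initial-state G degree≤3 girth vw
  in bound⇒boundHolds e {k} 2≤n 2^e≤n
       -- Since `n < 2 ^ (e+1)`, walks of length `d = e+1` suffice, whence `K = 2d+2`. The starting
       -- bound holds with `c = 2`.
       (iterate G degree≤3 girth {2 + (suc e + suc e)} (¬stuck G degree≤3 girth {suc e} connected n<2^[1+e])
         k-minimal n S u∈F (ℕ.m≤m+n n (length F)) (ℕ.m≤n+m _ _))
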